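{- Let $G=(V,E)$ be a connected graph. Then $G$ is bipartite if and only if for every edge $ab\in E$ the semicubes $W_{ab}$ and $W_{ba}$ form a partition of $V$ (that is, $W_{ab}\cap W_{ba}=\varnothing$ and $W_{ab}\cup W_{ba}=V$).
   Context: Graphs are simple, undirected, nonempty, and not necessarily finite. $d$ denotes the shortest-path distance in the connected graph $G$. For adjacent vertices $a,b\in V$ the semicube $W_{ab}$ is $W_{ab}=\{w\in V: d(w,a)<d(w,b)\}$; $W_{ab}$ and $W_{ba}$ are called opposite semicubes. -}

module Defs where

open import Axiom.ExcludedMiddle using (ExcludedMiddle)
open import Data.List using (List; []; _∷_)
open import Data.List.Relation.Unary.Unique.Propositional using (Unique)
open import Data.Nat using (ℕ; zero; suc; _≤_; _<_)
open import Data.Nat.Properties using (≮⇒≥)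
open import Data.Nat.Induction using (<-wellFounded; Acc; acc)
open import Data.Product using (Σ; ∃; ∃₂; _×_; _,_; proj₁; proj₂)
open import Data.Sum using (_⊎_)
open import Level using (Level; _⊔_; 0ℓ) renaming (suc to lsuc)
open import Relation.Binary.Core using (Rel)
open import Relation.Binary.Construct.Closure.ReflexiveTransitive using (Star; ε; _◅_)
open import Relation.Binary.Definitions using (Symmetric; Irreflexive)
open import Relation.Binary.PropositionalEquality using (_≡_; refl)
open import Relation.Nullary using (yes; no)
open import Relation.Unary using (Pred; _∩_; _∪_; Empty; Universal)

record Graph (v e : Level) : Set (lsuc (v ⊔ e)) where
  field
    Vertex     : Set v
    Adj        : Rel Vertex e
    symmetric  : Symmetric Adj
    noLoops    : Irreflexive _≡_ Adj
    nonempty   : Vertex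

-- The blocks may be empty, so that the one-vertex graph is bipartite.
IsPartition : ∀ {v p q} {V : Set v} → Pred V p → Pred V q → Set (v ⊔ p ⊔ q)
IsPartition P Q = Empty (P ∩ Q) × Universal (P ∪ Q)

module _ {v e} (G : Graph v e) where
  open Graph G

  Walk : Rel Vertex (v ⊔ e)
  Walk = Star Adj

  length : ∀ {x y} → Walk x y → ℕ
  length ε       = zero
  length (_ ◅ w) = suc (length w)

  vertices : ∀ {x y} → Walk x y → List Vertex
  vertices {x} ε       = x ∷ []
  vertices {x} (_ ◅ w) = x ∷ vertices w

  Path : Rel Vertex (v ⊔ e)
  Path x y = Σ (Walk x y) λ w → Unique (vertices w)

  pathLength : ∀ {x y} → Path x y → ℕ
  pathLength p = length (proj₁ p)

  Connected : Set (v ⊔ e)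
  Connected = ∀ x y → Path x y

  -- Minimising over the paths of an infinite graph is not computable, so the
  -- shortest-path distance is characterised rather than constructed.  The
  -- characterisation determines d x y uniquely, and `distance-exists` below
  -- shows that classically every connected graph has such a d.
  IsDistance : (Vertex → Vertex → ℕ) → Set (v ⊔ e)
  IsDistance d = ∀ x y → (∃ λ (p : Path x y) → pathLength p ≡ d x y)
                       × (∀ (p : Path x y) → d x y ≤ pathLength p)

  -- Level 0ℓ loses no generality: a predicate that is a block of a partition
  -- into two is decidable, hence equivalent to one at level 0ℓ.
  Bipartite : Set (v ⊔ e ⊔ lsuc 0ℓ)
  Bipartite = ∃₂ λ (A B : Pred Vertex 0ℓ) → IsPartition A B
            × (∀ x y → Adj x y → (A x × B y) ⊎ (B x × A y))

  Semicube : (Vertex → Vertex → ℕ) → Vertex → Vertex → Pred Vertex 0ℓ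
  Semicube d a b w = d w a < d w b

  distance-exists : ExcludedMiddle (v ⊔ e) → Connected → ∃ IsDistance
  distance-exists em connected =
    (λ x y → pathLength (proj₁ (shortest x y))) ,
    (λ x y → (proj₁ (shortest x y) , refl) , proj₂ (shortest x y))
    where
    Shortest : ∀ {x y} → Path x y → Set (v ⊔ e)
    Shortest {x} {y} p = ∀ (q : Path x y) → pathLength p ≤ pathLength q

    descend : ∀ {x y} (p : Path x y) → Acc _<_ (pathLength p) → ∃ (Shortest {x} {y})
    descend {x} {y} p (acc rs)
      with em {P = ∃ λ (q : Path x y) → pathLength q < pathLength p}
    ... | yes (q , q<p) = descend q (rs q<p)
    ... | no  ¬shorter  = p , λ q → ≮⇒≥ λ q<p → ¬shorter (q , q<p)

    shortest : ∀ x y → ∃ (Shortest {x} {y})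
    shortest x y = descend (connected x y) (<-wellFounded _)

{-# OPTIONS --safe #-}
-- If a and b are adjacent and c is a proper 2-colouring, then c a ≢ c b, whereas
-- walks of equal length from a common vertex end in the same colour; so d w a and
-- d w b differ for every w.  Conversely, d r a and d r b differ by at most one, so
-- if they are never equal, the parity of d r is a proper 2-colouring for any root r.
module Submission where

open import Defs
open import Data.Empty using (⊥; ⊥-elim)
open import Data.List.Membership.Propositional using (_∈_)
open import Data.List.Membership.DecPropositional using () renaming (_∈?_ to mem?)
open import Data.List.Relation.Unary.All using ([])
open import Data.List.Relation.Unary.All.Properties using (¬Any⇒All¬)
open import Data.List.Relation.Unary.AllPairs using ([]; _∷_)
open import Data.List.Relation.Unary.Any using (here; there)
open import Data.List.Relation.Unary.Unique.Propositional using (Unique)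
open import Data.Nat using (ℕ; suc; _≤_; _<_; z≤n; s≤s; parity)
open import Data.Nat.Properties
  using (≤-refl; ≤-trans; ≤-antisym; m≤n⇒m≤1+n; n≤0⇒n≡0; suc-injective; <-asym; <-cmp; _≟_;
         module ≤-Reasoning)
open import Data.Parity using (Parity; 0ℙ; 1ℙ; _⁻¹)
open import Data.Parity.Properties using (p≢p⁻¹; suc-homo-⁻¹; ⁻¹-selfInverse)
open import Data.Product using (∃; _×_; _,_)
open import Data.Sum using (_⊎_; inj₁; inj₂)
open import Function.Base using (_∘_)
open import Function.Bundles using (_⇔_; mk⇔)
open import Relation.Binary.Construct.Closure.ReflexiveTransitive using (ε; _◅_; _◅◅_)
open import Relation.Binary.Definitions using (DecidableEquality; tri<; tri≈; tri>)
open import Relation.Binary.PropositionalEquality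
  using (_≡_; _≢_; refl; sym; trans; cong)
open import Relation.Nullary using (yes; no)
open import Relation.Nullary.Decidable using (map′)

module _ {v e} (G : Graph v e) where
  open Graph G

  -- Stating properness as a flip, rather than as `c x ≢ c y`, gives an equation that can be chained
  -- along walks; `Parity` as colour set lets the parity of a distance be a colour directly.
  IsTwoColouring : (Vertex → Parity) → Set _
  IsTwoColouring c = ∀ {x y} → Adj x y → c y ≡ c x ⁻¹

  bipartite⇒twoColouring : Bipartite G → ∃ IsTwoColouring
  bipartite⇒twoColouring (A , B , (disjoint , cover) , across) = colour , proper
    where
    colour : Vertex → Parity
    colour x with cover x
    ... | inj₁ _ = 0ℙ
    ... | inj₂ _ = 1ℙ

    -- `colour` follows whichever disjunct `cover` happens to return; disjointness of the blocks
    -- forces that choice to agree with actual membership.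
    colour-A : ∀ {x} → A x → colour x ≡ 0ℙ
    colour-A {x} Ax with cover x
    ... | inj₁ _  = refl
    ... | inj₂ Bx = ⊥-elim (disjoint x (Ax , Bx))

    colour-B : ∀ {x} → B x → colour x ≡ 1ℙ
    colour-B {x} Bx with cover x
    ... | inj₁ Ax = ⊥-elim (disjoint x (Ax , Bx))
    ... | inj₂ _  = refl

    proper : IsTwoColouring colour
    proper {x} {y} xy with across x y xy
    ... | inj₁ (Ax , By) rewrite colour-A Ax | colour-B By = refl
    ... | inj₂ (Bx , Ay) rewrite colour-B Bx | colour-A Ay = refl

  twoColouring⇒bipartite : ∀ {c} → IsTwoColouring c → Bipartite G
  twoColouring⇒bipartite {c} proper =
    (λ x → c x ≡ 0ℙ) , (λ x → c x ≡ 1ℙ) , (disjoint , cover) , across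
    where
    disjoint : ∀ x → c x ≡ 0ℙ × c x ≡ 1ℙ → ⊥
    disjoint x (p , q) with () ← trans (sym p) q

    cover : ∀ x → c x ≡ 0ℙ ⊎ c x ≡ 1ℙ
    cover x with c x
    ... | 0ℙ = inj₁ refl
    ... | 1ℙ = inj₂ refl

    across : ∀ x y → Adj x y → (c x ≡ 0ℙ × c y ≡ 1ℙ) ⊎ (c x ≡ 1ℙ × c y ≡ 0ℙ)
    across x y xy with cover x
    ... | inj₁ p = inj₁ (p , trans (proper xy) (cong _⁻¹ p))
    ... | inj₂ p = inj₂ (p , trans (proper xy) (cong _⁻¹ p))

  -- Every step flips the colour. The starting points are kept apart because after one step the two
  -- walks may stand at different vertices, of which only the colours agree.
  equalLength⇒equalColour : ∀ {c} → IsTwoColouring c → ∀ {x x′ y y′} → c x ≡ c x′ →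
    (p : Walk G x y) (q : Walk G x′ y′) → length G p ≡ length G q → c y ≡ c y′
  equalLength⇒equalColour proper eq ε       ε        _   = eq
  equalLength⇒equalColour proper eq (s ◅ p) (s′ ◅ q) len =
    equalLength⇒equalColour proper
      (trans (proper s) (trans (cong _⁻¹ eq) (sym (proper s′)))) p q (suc-injective len)

  length-snoc : ∀ {x y z} (p : Walk G x y) (s : Adj y z) →
                length G (p ◅◅ (s ◅ ε)) ≡ suc (length G p)
  length-snoc ε       s = refl
  length-snoc (_ ◅ p) s = cong suc (length-snoc p s)

  suffixFrom : ∀ {x y z} (p : Walk G x y) → Unique (vertices G p) → z ∈ vertices G p →
               ∃ λ (q : Path G z y) → pathLength G q ≤ length G p
  suffixFrom ε       u       (here refl) = (ε , u) , z≤n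
  suffixFrom (s ◅ p) u       (here refl) = (s ◅ p , u) , ≤-refl
  suffixFrom (_ ◅ p) (_ ∷ u) (there z∈p) with suffixFrom p u z∈p
  ... | q , q≤p = q , m≤n⇒m≤1+n q≤p

  -- Loop erasure: the tail is reduced to a path first. If `x` recurs on it, the part of that path
  -- from `x` onwards already suffices; otherwise the first step can be put back in front.
  walk⇒path : DecidableEquality Vertex → ∀ {x y} (p : Walk G x y) →
              ∃ λ (q : Path G x y) → pathLength G q ≤ length G p
  walk⇒path _≟ᵥ_ ε = (ε , [] ∷ []) , z≤n
  walk⇒path _≟ᵥ_ {x} (s ◅ p) with walk⇒path _≟ᵥ_ p
  ... | (q , u) , q≤p with mem? _≟ᵥ_ x (vertices G q)
  ...   | no  x∉q = (s ◅ q , ¬Any⇒All¬ _ x∉q ∷ u) , s≤s q≤p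
  ...   | yes x∈q with suffixFrom q u x∈q
  ...     | r , r≤q = r , m≤n⇒m≤1+n (≤-trans r≤q q≤p)

  module _ {d : Vertex → Vertex → ℕ} (isDistance : IsDistance G d) where

    geodesic : ∀ x y → ∃ λ (p : Walk G x y) → length G p ≡ d x y
    geodesic x y with isDistance x y
    ... | ((p , _) , eq) , _ = p , eq

    d≡0⇒≡ : ∀ {x y} → d x y ≡ 0 → x ≡ y
    d≡0⇒≡ {x} {y} d≡0 with geodesic x y
    ... | ε     , _  = refl
    ... | _ ◅ _ , eq with () ← trans eq d≡0

    ≡⇒d≡0 : ∀ {x y} → x ≡ y → d x y ≡ 0
    ≡⇒d≡0 {x} refl with isDistance x x
    ... | _ , minimal = n≤0⇒n≡0 (minimal (ε , [] ∷ []))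

    -- Needed to cut loops out of a walk; equality of vertices is not decidable a priori.
    vertex≟ : DecidableEquality Vertex
    vertex≟ x y = map′ d≡0⇒≡ ≡⇒d≡0 (d x y ≟ 0)

    -- `IsDistance` bounds `d` by paths only, but a geodesic extended by an edge may revisit a
    -- vertex, so `d-adj` needs the bound for walks.
    d≤length : ∀ {x y} (p : Walk G x y) → d x y ≤ length G p
    d≤length {x} {y} p with walk⇒path vertex≟ p | isDistance x y
    ... | q , q≤p | _ , minimal = ≤-trans (minimal q) q≤p

    d-adj : ∀ w {a b} → Adj a b → d w b ≤ suc (d w a)
    d-adj w {a} {b} ab with geodesic w a
    ... | p , eq = begin
      d w b                        ≤⟨ d≤length (p ◅◅ (ab ◅ ε)) ⟩
      length G (p ◅◅ (ab ◅ ε))     ≡⟨ length-snoc p ab ⟩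
      suc (length G p)             ≡⟨ cong suc eq ⟩
      suc (d w a)                  ∎
      where open ≤-Reasoning

    twoColouring⇒d≢ : ∀ {c} → IsTwoColouring c → ∀ w {a b} → Adj a b → d w a ≢ d w b
    twoColouring⇒d≢ {c} proper w {a} {b} ab da≡db with geodesic w a | geodesic w b
    ... | p , p≡ | q , q≡ = p≢p⁻¹ (c a) (trans
      (equalLength⇒equalColour proper refl p q (trans p≡ (trans da≡db (sym q≡))))
      (proper ab))

    d≢⇒semicubePartition : ∀ {a b} → (∀ w → d w a ≢ d w b) →
                           IsPartition (Semicube G d a b) (Semicube G d b a)
    d≢⇒semicubePartition {a} {b} d≢ = (λ _ (lt , gt) → <-asym lt gt) , cover
      where
      cover : ∀ w → d w a < d w b ⊎ d w b < d w a
      cover w with <-cmp (d w a) (d w b)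
      ... | tri< lt _ _ = inj₁ lt
      ... | tri≈ _ eq _ = ⊥-elim (d≢ w eq)
      ... | tri> _ _ gt = inj₂ gt

    semicubePartition⇒parityColouring :
      (∀ a b → Adj a b → IsPartition (Semicube G d a b) (Semicube G d b a)) →
      ∀ r → IsTwoColouring (parity ∘ d r)
    semicubePartition⇒parityColouring partition r {a} {b} ab with partition a b ab
    ... | _ , cover with cover r
    -- With `d-adj`, the strict inequality becomes `d r b ≡ suc (d r a)`, and a successor flips the
    -- parity; the other case is the same with `a` and `b` exchanged.
    ...   | inj₁ lt = sym (⁻¹-selfInverse
      (trans (cong (λ n → parity n ⁻¹) (≤-antisym (d-adj r ab) lt)) (suc-homo-⁻¹ (d r a))))
    ...   | inj₂ gt = trans (sym (suc-homo-⁻¹ (d r b)))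
      (cong (λ n → parity n ⁻¹) (≤-antisym gt (d-adj r (symmetric ab))))

theorem3p1 : ∀ {v e} (G : Graph v e) → let open Graph G in
    Connected G →
    (d : Vertex → Vertex → ℕ) → IsDistance G d →
    Bipartite G ⇔ (∀ a b → Adj a b → IsPartition (Semicube G d a b) (Semicube G d b a))
theorem3p1 G _ d isDistance = mk⇔
  (λ bipartite a b ab → let _ , proper = bipartite⇒twoColouring G bipartite in
    d≢⇒semicubePartition G isDistance λ w → twoColouring⇒d≢ G isDistance proper w ab)
  (λ partition → twoColouring⇒bipartite G
    -- Any vertex can be the root; `nonempty` supplies one.
    (semicubePartition⇒parityColouring G isDistance partition (Graph.nonempty G)))
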